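{- Let $n$ be a positive integer and let $K$ and $L$ be number fields of degree $n$, both Galois over $\mathbb{Q}$, contained in a fixed algebraic closure of $\mathbb{Q}$. If $\delta_{K,L}>1-\frac{2}{n^2}$, then $K=L$.
   Context: $\widetilde E$ denotes the Galois closure of a number field $E$ over $\mathbb{Q}$ and $\widetilde K\widetilde L$ the compositum; $\delta_{K,L}:=\frac{2}{[\widetilde K\widetilde L:\mathbb{Q}]}+1-\frac{1}{[\widetilde K:\mathbb{Q}]}-\frac{1}{[\widetilde L:\mathbb{Q}]}$. -}

module Defs where

open import Level using (Level; _⊔_; suc)
open import Algebra.Apartness.Bundles using (HeytingField; HeytingCommutativeRing)
open import Algebra.Bundles using (CommutativeRing)
open import Algebra.Bundles.Raw using (RawRing)
open import Algebra.Morphism.Structures using (IsRingHomomorphism; IsRingIsomorphism)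
import Algebra.Properties.Semiring.Exp as Exp
import Algebra.Properties.Semiring.Sum as Sum
open import Data.Empty using (⊥; ⊥-elim)
open import Data.Fin.Base using (Fin; fromℕ; toℕ)
open import Data.Integer.Base using (+_)
open import Data.Nat.Base as ℕ using (ℕ; NonZero)
open import Data.Product.Base using (∃; ∃-syntax; Σ-syntax; _×_; _,_; proj₁)
open import Data.Rational.Base as ℚ using (ℚ; 0ℚ; 1ℚ)
open import Relation.Binary.PropositionalEquality.Core using (_≡_; _≢_)
open import Relation.Unary using (Pred; _⊆_)

-- Fields are the library's Heyting fields: x # y means that x - y is
-- invertible.  Classically, # is just the negation of ≈.
record AlgebraicClosureOfℚ (c ℓ₁ ℓ₂ : Level) : Set (suc (c ⊔ ℓ₁ ⊔ ℓ₂)) where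
  field
    heytingField : HeytingField c ℓ₁ ℓ₂

  open HeytingField heytingField public
    using (Carrier; _≈_; _#_; _+_; _*_; -_; 0#; 1#; heytingCommutativeRing)
  open HeytingCommutativeRing heytingCommutativeRing public
    using (commutativeRing)
  open CommutativeRing commutativeRing public
    using (rawRing; semiring; refl; trans; +-cong; *-cong)
  open Exp semiring public using (_^_)
  open Sum semiring public using (sum)

  -- The coefficients are listed by increasing degree.
  evalPoly : ∀ {n} → (Fin n → Carrier) → Carrier → Carrier
  evalPoly a x = sum (λ i → a i * x ^ toℕ i)

  field
    ι                   : ℚ → Carrier
    ι-isHomomorphism    : IsRingHomomorphism ℚ.+-*-rawRing rawRing ι
    algebraicallyClosed : ∀ n (a : Fin (2 ℕ.+ n) → Carrier) →
                          a (fromℕ (1 ℕ.+ n)) # 0# →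
                          ∃[ x ] evalPoly a x ≈ 0#
    algebraic           : ∀ x → Σ[ n ∈ ℕ ] Σ[ a ∈ (Fin n → ℚ) ]
                          (∃[ i ] a i ≢ 0ℚ) ×
                          evalPoly (λ i → ι (a i)) x ≈ 0#

record Subfield {c ℓ₁ ℓ₂} (Q̄ : AlgebraicClosureOfℚ c ℓ₁ ℓ₂) (p : Level)
       : Set (c ⊔ ℓ₁ ⊔ suc p) where
  open AlgebraicClosureOfℚ Q̄
  field
    member     : Pred Carrier p
    resp       : ∀ {x y} → x ≈ y → member x → member y
    0-closed   : member 0#
    1-closed   : member 1#
    +-closed   : ∀ {x y} → member x → member y → member (x + y)
    *-closed   : ∀ {x y} → member x → member y → member (x * y)
    neg-closed : ∀ {x} → member x → member (- x)
    inv-closed : ∀ {x y} → member x → x * y ≈ 1# → member y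

open Subfield public using (member)

module _ {c ℓ₁ ℓ₂} {Q̄ : AlgebraicClosureOfℚ c ℓ₁ ℓ₂} where
  open AlgebraicClosureOfℚ Q̄

  record [_:ℚ]≡_ {p} (E : Subfield Q̄ p) (d : ℕ) : Set (c ⊔ ℓ₁ ⊔ p) where
    field
      basis       : Fin d → Carrier
      inside      : ∀ i → member E (basis i)
      independent : ∀ (q : Fin d → ℚ) →
                    sum (λ i → ι (q i) * basis i) ≈ 0# →
                    ∀ i → q i ≡ 0ℚ
      spanning    : ∀ x → member E x →
                    Σ[ q ∈ (Fin d → ℚ) ] x ≈ sum (λ i → ι (q i) * basis i)

  1≉0 : 1# ≈ 0# → ⊥
  1≉0 1≈0 = #-irrefl 1≈0
    (invertible⇒# (1# , trans (*-cong refl 1-0≈1) (*-identityˡ 1#)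
                      , trans (*-cong 1-0≈1 refl) (*-identityˡ 1#)))
    where
    open HeytingField heytingField using (#-irrefl; invertible⇒#)
    open CommutativeRing commutativeRing using (_-_; ring; *-identityˡ; +-identityʳ)
    open import Algebra.Properties.Ring ring using (-0#≈0#)
    1-0≈1 : 1# - 0# ≈ 1#
    1-0≈1 = trans (+-cong refl -0#≈0#) (+-identityʳ 1#)

  degree-nonZero : ∀ {p} {E : Subfield Q̄ p} {d} → [ E :ℚ]≡ d → NonZero d
  degree-nonZero {E = E} {d = ℕ.zero} deg
    with _ , 1≈0 ← [_:ℚ]≡_.spanning deg 1# (Subfield.1-closed E) = ⊥-elim (1≉0 1≈0)
  degree-nonZero {d = ℕ.suc _} _ = _

  subfieldRawRing : ∀ {p} → Subfield Q̄ p → RawRing (c ⊔ p) ℓ₁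
  subfieldRawRing E = record
    { Carrier = ∃ (member E)
    ; _≈_     = λ x y → proj₁ x ≈ proj₁ y
    ; _+_     = λ (x , x∈E) (y , y∈E) → x + y , +-closed x∈E y∈E
    ; _*_     = λ (x , x∈E) (y , y∈E) → x * y , *-closed x∈E y∈E
    ; -_      = λ (x , x∈E) → - x , neg-closed x∈E
    ; 0#      = 0# , 0-closed
    ; 1#      = 1# , 1-closed
    }
    where open Subfield E

  record Automorphism {p} (E : Subfield Q̄ p) : Set (c ⊔ ℓ₁ ⊔ p) where
    field
      σ             : ∃ (member E) → ∃ (member E)
      isIsomorphism : IsRingIsomorphism (subfieldRawRing E) (subfieldRawRing E) σ
      fixes-ℚ       : ∀ x q → proj₁ x ≈ ι q → proj₁ (σ x) ≈ ι q

  -- E/ℚ is algebraic because Q̄/ℚ is, so it is Galois when the fixed field of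
  -- Aut(E/ℚ) is ℚ.
  IsGalois : ∀ {p} → Subfield Q̄ p → Set (c ⊔ ℓ₁ ⊔ p)
  IsGalois E = ∀ (x : ∃ (member E)) →
               (∀ (τ : Automorphism E) → proj₁ (Automorphism.σ τ x) ≈ proj₁ x) →
               ∃[ q ] proj₁ x ≈ ι q

  -- The smallest Galois extension of ℚ in Q̄ containing E, as an intersection.
  -- Subfields at level c ⊔ ℓ₁ suffice: this level contains the ℚ-span of
  -- every finite family, hence every number field up to equality of sets.
  galoisClosure : ∀ {p} → Subfield Q̄ p → Subfield Q̄ (suc (c ⊔ ℓ₁) ⊔ p)
  galoisClosure E = record
    { member     = λ x → ∀ (M : Subfield Q̄ (c ⊔ ℓ₁)) → IsGalois M →
                         member E ⊆ member M → member M x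
    ; resp       = λ x≈y x∈ M g i → resp M x≈y (x∈ M g i)
    ; 0-closed   = λ M _ _ → 0-closed M
    ; 1-closed   = λ M _ _ → 1-closed M
    ; +-closed   = λ x∈ y∈ M g i → +-closed M (x∈ M g i) (y∈ M g i)
    ; *-closed   = λ x∈ y∈ M g i → *-closed M (x∈ M g i) (y∈ M g i)
    ; neg-closed = λ x∈ M g i → neg-closed M (x∈ M g i)
    ; inv-closed = λ x∈ xy≈1 M g i → inv-closed M (x∈ M g i) xy≈1
    }
    where open Subfield

  data InCompositum {p q} (E : Subfield Q̄ p) (F : Subfield Q̄ q)
       : Pred Carrier (c ⊔ ℓ₁ ⊔ p ⊔ q) where
    left  : ∀ {x} → member E x → InCompositum E F x
    right : ∀ {x} → member F x → InCompositum E F x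
    resp  : ∀ {x y} → x ≈ y → InCompositum E F x → InCompositum E F y
    plus  : ∀ {x y} → InCompositum E F x → InCompositum E F y → InCompositum E F (x + y)
    times : ∀ {x y} → InCompositum E F x → InCompositum E F y → InCompositum E F (x * y)
    neg   : ∀ {x} → InCompositum E F x → InCompositum E F (- x)
    inv   : ∀ {x y} → InCompositum E F x → x * y ≈ 1# → InCompositum E F y

  compositum : ∀ {p q} → Subfield Q̄ p → Subfield Q̄ q → Subfield Q̄ (c ⊔ ℓ₁ ⊔ p ⊔ q)
  compositum E F = record
    { member     = InCompositum E F
    ; resp       = resp
    ; 0-closed   = left (Subfield.0-closed E)
    ; 1-closed   = left (Subfield.1-closed E)
    ; +-closed   = plus
    ; *-closed   = times
    ; neg-closed = neg
    ; inv-closed = inv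
    }

  -- IsDelta K L r means δ_{K,L} = r.  It is a relation because a degree is
  -- given by exhibiting a basis; the degrees are determined by the fields.
  record IsDelta {p q} (K : Subfield Q̄ p) (L : Subfield Q̄ q) (r : ℚ)
         : Set (suc (c ⊔ ℓ₁) ⊔ p ⊔ q) where
    field
      {dK dL dKL} : ℕ
      degK  : [ galoisClosure K :ℚ]≡ dK
      degL  : [ galoisClosure L :ℚ]≡ dL
      degKL : [ compositum (galoisClosure K) (galoisClosure L) :ℚ]≡ dKL

    private instance
      dK≢0 : NonZero dK
      dK≢0 = degree-nonZero degK
      dL≢0 : NonZero dL
      dL≢0 = degree-nonZero degL
      dKL≢0 : NonZero dKL
      dKL≢0 = degree-nonZero degKL

    field
      value : r ≡ (+ 2 ℚ./ dKL) ℚ.+ 1ℚ ℚ.- (+ 1 ℚ./ dK) ℚ.- (+ 1 ℚ./ dL)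

{-# OPTIONS --safe #-}

-- K and L are their own Galois closures, and for n ≥ 2 the bound on δ forces
-- [KL : ℚ] < 2n.  Let b₁, …, b_n be a basis of K and x ∈ L.  The 2n elements
-- b_i and x b_i of KL satisfy a nontrivial relation over ℚ, that is t + x s = 0
-- with s, t ∈ K and s ≠ 0, so x = - t / s ∈ K.  By symmetry K = L.  For n = 1
-- the bound says nothing, but the same argument for the family (1) inside L
-- shows L ⊆ K.
module Submission where

open import Defs
open import Level using (Level; _⊔_)
open import Data.Integer.Base using (+_)
open import Data.Nat.Base using (ℕ; NonZero; _^_)
open import Data.Nat.Properties using (m^n≢0)
open import Data.Rational.Base using (ℚ; 1ℚ; _/_; _-_; _>_)
open import Relation.Unary using (_≐_)

open import Algebra.Apartness.Bundles using (HeytingField)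
open import Algebra.Bundles using (CommutativeRing)
open import Algebra.Morphism.Structures using (IsRingHomomorphism)
import Algebra.Properties.CommutativeSemigroup as CommutativeSemigroupProperties
import Algebra.Properties.Group as GroupProperties
import Algebra.Properties.Ring as RingProperties
import Algebra.Properties.Semiring.Sum as SemiringSum
open import Data.Fin.Base using (Fin; zero; suc; punchIn; _↑ˡ_; _↑ʳ_; splitAt; join)
open import Data.Fin.Properties using (any?; join-splitAt)
open import Data.Integer.Base as ℤ using (-[1+_])
import Data.Integer.Properties as ℤ
open import Data.Nat.Base as ℕ using (zero; suc; s≤s; z≤n)
import Data.Nat.Properties as ℕ
open import Data.Product.Base using (∃-syntax; Σ-syntax; _×_; _,_; proj₁; proj₂)
open import Data.Rational.Base as ℚ using (0ℚ; 1/_; ↥_; ↧ₙ_; toℚᵘ; ≢-nonZero)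
import Data.Rational.Properties as ℚ
import Data.Rational.Solver as ℚ-Solver
open import Data.Rational.Unnormalised.Base as ℚᵘ using (mkℚᵘ)
import Data.Rational.Unnormalised.Properties as ℚᵘ
open import Data.Sum.Base using (inj₁; inj₂)
open import Data.Vec.Functional using (_∷_; _++_; tail; insertAt)
open import Data.Vec.Functional.Properties
  using (insertAt-lookup; insertAt-punchIn; lookup-++ˡ; lookup-++ʳ)
open import Data.Vec.Functional.Relation.Unary.All.Properties using (++⁺)
open import Function.Base using (_∘_)
open import Relation.Binary.PropositionalEquality
  using (_≡_; _≢_; refl; sym; trans; cong; cong₂; subst; module ≡-Reasoning)
import Relation.Binary.Reasoning.Setoid as ≈-Reasoning
open import Relation.Nullary using (¬_; yes; no)
open import Relation.Nullary.Decidable using (¬?; decidable-stable)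

-- Homogeneous linear systems over ℚ.

private
  module ℚΣ = SemiringSum (CommutativeRing.semiring ℚ.+-*-commutativeRing)

*-≢0 : ∀ {p q} → p ≢ 0ℚ → q ≢ 0ℚ → p ℚ.* q ≢ 0ℚ
*-≢0 {p} {q} p≢0 q≢0 pq≡0 = q≢0 (begin
  q                     ≡⟨ ℚ.*-identityˡ q ⟨
  1ℚ ℚ.* q              ≡⟨ cong (ℚ._* q) (ℚ.*-inverseˡ p) ⟨
  (1/ p) ℚ.* p ℚ.* q    ≡⟨ ℚ.*-assoc (1/ p) p q ⟩
  (1/ p) ℚ.* (p ℚ.* q)  ≡⟨ cong ((1/ p) ℚ.*_) pq≡0 ⟩
  (1/ p) ℚ.* 0ℚ         ≡⟨ ℚ.*-zeroʳ (1/ p) ⟩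
  0ℚ                    ∎)
  where
  open ≡-Reasoning
  instance _ = ≢-nonZero p≢0

-- Gaussian elimination with cross-multiplied rows, so that no division occurs.
linearRelation : ∀ {m d} → d ℕ.< m → (w : Fin m → Fin d → ℚ) →
                 Σ[ q ∈ (Fin m → ℚ) ] (∃[ i ] q i ≢ 0ℚ) ×
                 (∀ j → ℚΣ.sum (λ i → q i ℚ.* w i j) ≡ 0ℚ)
linearRelation {suc m} {zero} _ w = (λ _ → 1ℚ) , (zero , λ ()) , λ ()
linearRelation {suc m} {suc d} (s≤s d<m) w with any? (λ i → ¬? (w i zero ℚ.≟ 0ℚ))
-- Column `zero` vanishes, so its equation holds for every `q` and only `d` equations in `suc m`
-- unknowns remain.
... | no noPivot with q , q≢0 , rel ← linearRelation (ℕ.m≤n⇒m≤1+n d<m) (tail ∘ w) =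
  q , q≢0 , λ where
    zero    → trans (ℚΣ.sum-cong-≗ (λ i → trans
                (cong (q i ℚ.*_) (decidable-stable (w i zero ℚ.≟ 0ℚ) (λ wi≢0 → noPivot (i , wi≢0))))
                (ℚ.*-zeroʳ (q i))))
                (ℚΣ.sum-replicate-zero (suc m))
    (suc j) → rel j
... | yes (p , a≢0) = q , (punchIn p (proj₁ q′≢0) , q≢0) , rel
  where
  a = w p zero

  v : Fin m → Fin (suc d) → ℚ
  v i = w (punchIn p i)

  reduced : Fin m → Fin (suc d) → ℚ
  reduced i j = a ℚ.* v i j ℚ.- v i zero ℚ.* w p j

  -- Column `zero` of `reduced` is identically zero, so solving for the other `d` columns solves for
  -- all of them, as `rel′` records.
  ih   = linearRelation d<m (tail ∘ reduced)
  q′   = proj₁ ih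
  q′≢0 = proj₁ (proj₂ ih)

  rel′ : ∀ j → ℚΣ.sum (λ i → q′ i ℚ.* reduced i j) ≡ 0ℚ
  rel′ zero = trans (ℚΣ.sum-cong-≗ (λ i →
      solve 3 (λ x a y → x :* (a :* y :- y :* a) := con 0ℚ) refl (q′ i) a (v i zero)))
    (ℚΣ.sum-replicate-zero m)
    where open ℚ-Solver.+-*-Solver
  rel′ (suc j) = proj₂ (proj₂ ih) j

  -- Expanding the relation among the reduced rows, each row `v i` collects the coefficient
  -- `a ℚ.* q′ i`, and the pivot row collects this sum. Since `a` is nonzero, a nonzero `q′ i` stays
  -- nonzero after scaling.
  q₀ = ℚΣ.sum (λ i → ℚ.- (q′ i ℚ.* v i zero))

  q : Fin (suc m) → ℚ
  q = insertAt (λ i → a ℚ.* q′ i) p q₀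

  q≢0 : q (punchIn p (proj₁ q′≢0)) ≢ 0ℚ
  q≢0 = subst (_≢ 0ℚ) (sym (insertAt-punchIn (λ i → a ℚ.* q′ i) p q₀ (proj₁ q′≢0)))
              (*-≢0 a≢0 (proj₂ q′≢0))

  rel : ∀ j → ℚΣ.sum (λ i → q i ℚ.* w i j) ≡ 0ℚ
  rel j = begin
    ℚΣ.sum (λ i → q i ℚ.* w i j)
      ≡⟨ ℚΣ.sum-remove {i = p} (λ i → q i ℚ.* w i j) ⟩
    q p ℚ.* w p j ℚ.+ ℚΣ.sum (λ i → q (punchIn p i) ℚ.* v i j)
      ≡⟨ cong₂ ℚ._+_
           (cong (ℚ._* w p j) (insertAt-lookup _ p q₀))
           (ℚΣ.sum-cong-≗ (λ i → cong (ℚ._* v i j) (insertAt-punchIn _ p q₀ i))) ⟩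
    q₀ ℚ.* w p j ℚ.+ ℚΣ.sum (λ i → a ℚ.* q′ i ℚ.* v i j)
      ≡⟨ cong (ℚ._+ ℚΣ.sum (λ i → a ℚ.* q′ i ℚ.* v i j)) (ℚΣ.*-distribʳ-sum (w p j) (λ i → ℚ.- (q′ i ℚ.* v i zero))) ⟩
    ℚΣ.sum (λ i → ℚ.- (q′ i ℚ.* v i zero) ℚ.* w p j) ℚ.+ ℚΣ.sum (λ i → a ℚ.* q′ i ℚ.* v i j)
      ≡⟨ ℚΣ.∑-distrib-+ (λ i → ℚ.- (q′ i ℚ.* v i zero) ℚ.* w p j) (λ i → a ℚ.* q′ i ℚ.* v i j) ⟨
    ℚΣ.sum (λ i → ℚ.- (q′ i ℚ.* v i zero) ℚ.* w p j ℚ.+ a ℚ.* q′ i ℚ.* v i j)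
      ≡⟨ ℚΣ.sum-cong-≗ (λ i → solve 5
           (λ x y u a z → :- (x :* y) :* u :+ a :* x :* z := x :* (a :* z :- y :* u))
           refl (q′ i) (v i zero) (w p j) a (v i j)) ⟩
    ℚΣ.sum (λ i → q′ i ℚ.* reduced i j)
      ≡⟨ rel′ j ⟩
    0ℚ ∎
    where
    open ≡-Reasoning
    open ℚ-Solver.+-*-Solver

-- Fractions and the numerical bound on the degree of the compositum.

/-mono-≤ : ∀ {a b c d} .{{_ : NonZero b}} .{{_ : NonZero d}} →
           a ℕ.* d ℕ.≤ c ℕ.* b → (+ a) / b ℚ.≤ (+ c) / d
-- `_/_` reduces to lowest terms; the unnormalised rationals keep the given numerators and
-- denominators, and there the order is cross-multiplication.
/-mono-≤ {a} {suc b} {c} {suc d} ad≤cb = ℚ.toℚᵘ-cancel-≤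
  (ℚᵘ.≤-respˡ-≃ (ℚᵘ.≃-sym (ℚ.toℚᵘ-fromℚᵘ (mkℚᵘ (+ a) b)))
  (ℚᵘ.≤-respʳ-≃ (ℚᵘ.≃-sym (ℚ.toℚᵘ-fromℚᵘ (mkℚᵘ (+ c) d)))
  (ℚᵘ.*≤* (begin
    + a ℤ.* + suc d    ≡⟨ ℤ.pos-* a (suc d) ⟨
    + (a ℕ.* suc d)    ≤⟨ ℤ.+≤+ ad≤cb ⟩
    + (c ℕ.* suc b)    ≡⟨ ℤ.pos-* c (suc b) ⟩
    + c ℤ.* + suc b    ∎))))
  where open ℤ.≤-Reasoning

1+m/1 : ∀ m → (+ suc m) / 1 ≡ 1ℚ ℚ.+ (+ m) / 1
1+m/1 m = ℚ.toℚᵘ-injective (begin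
  toℚᵘ ((+ suc m) / 1)              ≈⟨ ℚ.toℚᵘ-fromℚᵘ (mkℚᵘ (+ suc m) 0) ⟩
  mkℚᵘ (+ suc m) 0                  ≈⟨ ℚᵘ.*≡* (cong (ℤ._* + 1) (cong (ℤ._+_ (+ 1)) (sym (ℤ.*-identityʳ (+ m))))) ⟩
  ℚᵘ.1ℚᵘ ℚᵘ.+ mkℚᵘ (+ m) 0          ≈⟨ ℚᵘ.+-congʳ ℚᵘ.1ℚᵘ (ℚ.toℚᵘ-fromℚᵘ (mkℚᵘ (+ m) 0)) ⟨
  ℚᵘ.1ℚᵘ ℚᵘ.+ toℚᵘ ((+ m) / 1)      ≈⟨ ℚ.toℚᵘ-homo-+ 1ℚ ((+ m) / 1) ⟨
  toℚᵘ (1ℚ ℚ.+ (+ m) / 1)           ∎)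
  where open ≈-Reasoning ℚᵘ.≃-setoid

m/d*d : ∀ m d .{{_ : NonZero d}} → (+ m) / d ℚ.* ((+ d) / 1) ≡ (+ m) / 1
m/d*d m (suc d) = ℚ.toℚᵘ-injective (begin
  toℚᵘ ((+ m) / suc d ℚ.* ((+ suc d) / 1))             ≈⟨ ℚ.toℚᵘ-homo-* ((+ m) / suc d) ((+ suc d) / 1) ⟩
  toℚᵘ ((+ m) / suc d) ℚᵘ.* toℚᵘ ((+ suc d) / 1)     ≈⟨ ℚᵘ.*-cong (ℚ.toℚᵘ-fromℚᵘ (mkℚᵘ (+ m) d)) (ℚ.toℚᵘ-fromℚᵘ (mkℚᵘ (+ suc d) 0)) ⟩
  mkℚᵘ (+ m) d ℚᵘ.* mkℚᵘ (+ suc d) 0                 ≈⟨ ℚᵘ.*≡* (ℤ.*-assoc (+ m) (+ suc d) (+ 1)) ⟩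
  mkℚᵘ (+ m) 0                                       ≈⟨ ℚ.toℚᵘ-fromℚᵘ (mkℚᵘ (+ m) 0) ⟨
  toℚᵘ ((+ m) / 1)                                   ∎)
  where open ≈-Reasoning ℚᵘ.≃-setoid

-- Suppose D ≥ 2n. Then 2/D ≤ 1/n, which cancels against 1/a ≥ 1/n, while n ≥ 2 gives 1/b ≥ 1/n ≥
-- 2/n². The left side is then at most 1 - 2/n², a contradiction.
δ-bound : ∀ {n D a b} .{{_ : NonZero n}} .{{_ : NonZero D}} .{{_ : NonZero a}} .{{_ : NonZero b}} →
          2 ℕ.≤ n → a ℕ.≤ n → b ℕ.≤ n →
          (+ 2) / D ℚ.+ 1ℚ - (+ 1) / a - (+ 1) / b > 1ℚ - (_/_ (+ 2) (n ^ 2) {{m^n≢0 n 2}}) →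
          D ℕ.< n ℕ.+ n
δ-bound {n} {D} {a} {b} 2≤n a≤n b≤n δ> = ℕ.≰⇒> (λ 2n≤D → ℚ.<-irrefl refl (ℚ.<-≤-trans δ> (begin
  (+ 2) / D ℚ.+ 1ℚ - (+ 1) / a - (+ 1) / b
    ≤⟨ ℚ.+-mono-≤ (ℚ.+-mono-≤ (ℚ.+-monoˡ-≤ 1ℚ (2/D≤1/n 2n≤D)) (ℚ.neg-antimono-≤ (1/n≤1/ a≤n)))
                  (ℚ.neg-antimono-≤ (ℚ.≤-trans 2/n²≤1/n (1/n≤1/ b≤n))) ⟩
  (+ 1) / n ℚ.+ 1ℚ - (+ 1) / n - 2/n²
    ≡⟨ solve 3 (λ x y z → x :+ y :- x :- z := y :- z) refl ((+ 1) / n) 1ℚ 2/n² ⟩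
  1ℚ - 2/n² ∎)))
  where
  open ℚ.≤-Reasoning
  open ℚ-Solver.+-*-Solver
  instance _ = m^n≢0 n 2
  2/n² = (+ 2) / (n ^ 2)

  1/n≤1/ : ∀ {c} .{{_ : NonZero c}} → c ℕ.≤ n → (+ 1) / n ℚ.≤ (+ 1) / c
  1/n≤1/ {c} c≤n = /-mono-≤ {1} {n} {1} {c} (ℕ.*-monoʳ-≤ 1 c≤n)

  2/D≤1/n : n ℕ.+ n ℕ.≤ D → (+ 2) / D ℚ.≤ (+ 1) / n
  2/D≤1/n 2n≤D = /-mono-≤ {2} {D} {1} {n}
    (subst (ℕ._≤ 1 ℕ.* D) (cong (n ℕ.+_) (sym (ℕ.+-identityʳ n)))
      (subst (n ℕ.+ n ℕ.≤_) (sym (ℕ.*-identityˡ D)) 2n≤D))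

  2/n²≤1/n : 2/n² ℚ.≤ (+ 1) / n
  2/n²≤1/n = /-mono-≤ {2} {n ^ 2} {1} {n}
    (subst (2 ℕ.* n ℕ.≤_) n*n≡1*n² (ℕ.*-monoˡ-≤ n 2≤n))
    where
    n*n≡1*n² : n ℕ.* n ≡ 1 ℕ.* n ^ 2
    n*n≡1*n² = sym (trans (ℕ.*-identityˡ (n ^ 2)) (cong (n ℕ.*_) (ℕ.*-identityʳ n)))

-- Rational linear combinations in the algebraic closure.

module _ {c ℓ₁ ℓ₂} {Q̄ : AlgebraicClosureOfℚ c ℓ₁ ℓ₂} where
  open AlgebraicClosureOfℚ Q̄
    using (heytingField; commutativeRing; ι; ι-isHomomorphism)
  open HeytingField heytingField using (tight; #⇒invertible)
  open CommutativeRing commutativeRing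
    renaming (sym to ≈-sym; trans to ≈-trans) hiding (refl; _-_; zero)
  open SemiringSum semiring
  open CommutativeSemigroupProperties *-commutativeSemigroup using (x∙yz≈y∙xz)
  open RingProperties ring using (-‿distribʳ-*; -0#≈0#)
  open GroupProperties +-group using (inverseʳ-unique; inverseˡ-unique)
  open ≈-Reasoning setoid
  private module ι = IsRingHomomorphism ι-isHomomorphism

  ι-cong : ∀ {p q} → p ≡ q → ι p ≈ ι q
  ι-cong p≡q = reflexive (cong ι p≡q)

  ι-sum : ∀ {n} (f : Fin n → ℚ) → ι (ℚΣ.sum f) ≈ sum (ι ∘ f)
  ι-sum {zero}  f = ι.0#-homo
  ι-sum {suc n} f = ≈-trans (ι.+-homo (f zero) _) (+-congˡ (ι-sum (tail f)))

  -- A nonzero rational has an inverse, whose image would give 1 = 0. Equality on ℚ is decidable, so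
  -- refuting `q ≢ 0ℚ` is enough.
  ι-injective₀ : ∀ {q} → ι q ≈ 0# → q ≡ 0ℚ
  ι-injective₀ {q} ιq≈0 = decidable-stable (q ℚ.≟ 0ℚ) (λ q≢0 →
    let instance _ = ≢-nonZero q≢0 in 1≉0 {Q̄ = Q̄} (begin
      1#                 ≈⟨ ι.1#-homo ⟨
      ι 1ℚ               ≈⟨ ι-cong (ℚ.*-inverseʳ q) ⟨
      ι (q ℚ.* 1/ q)     ≈⟨ ι.*-homo q (1/ q) ⟩
      ι q * ι (1/ q)     ≈⟨ *-congʳ ιq≈0 ⟩
      0# * ι (1/ q)      ≈⟨ zeroˡ _ ⟩
      0#                 ∎))

  infix 8 _·_
  _·_ : ∀ {n} → (Fin n → ℚ) → (Fin n → Carrier) → Carrier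
  q · v = sum (λ i → ι (q i) * v i)

  -- Unfolds to the type of the field `independent` in `[_:ℚ]≡_`, so the independence of a basis can
  -- be passed as it is.
  Independent : ∀ {n} → (Fin n → Carrier) → Set ℓ₁
  Independent v = ∀ q → q · v ≈ 0# → ∀ i → q i ≡ 0ℚ

  ·-zero : ∀ {n} {q : Fin n → ℚ} (v : Fin n → Carrier) → (∀ i → q i ≡ 0ℚ) → q · v ≈ 0#
  ·-zero {n} {q} v q≡0 = begin
    q · v              ≈⟨ sum-cong-≋ (λ i → *-congʳ (≈-trans (ι-cong (q≡0 i)) ι.0#-homo)) ⟩
    sum (λ i → 0# * v i) ≈⟨ sum-cong-≋ (λ i → zeroˡ (v i)) ⟩
    sum {n} (λ _ → 0#)   ≈⟨ sum-replicate-zero n ⟩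
    0#                 ∎

  ·-*ˡ : ∀ {n} (q : Fin n → ℚ) s (v : Fin n → Carrier) → q · (λ i → s * v i) ≈ s * q · v
  ·-*ˡ {n} q s v = begin
    sum (λ i → ι (q i) * (s * v i))  ≈⟨ sum-cong-≋ {n} (λ i → x∙yz≈y∙xz (ι (q i)) s (v i)) ⟩
    sum (λ i → s * (ι (q i) * v i))  ≈⟨ *-distribˡ-sum s (λ i → ι (q i) * v i) ⟨
    s * q · v                        ∎

  sum-↑ : ∀ m {n} (f : Fin (m ℕ.+ n) → Carrier) →
          sum f ≈ sum (λ i → f (i ↑ˡ n)) + sum (λ i → f (m ↑ʳ i))
  sum-↑ zero    f = ≈-sym (+-identityˡ _)
  sum-↑ (suc m) f = ≈-trans (+-congˡ (sum-↑ m (tail f))) (≈-sym (+-assoc _ _ _))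

  ·-++ : ∀ {m n} (q : Fin (m ℕ.+ n) → ℚ) (v : Fin m → Carrier) (w : Fin n → Carrier) →
         q · (v ++ w) ≈ (λ i → q (i ↑ˡ n)) · v + (λ i → q (m ↑ʳ i)) · w
  ·-++ {m} {n} q v w = ≈-trans (sum-↑ m (λ i → ι (q i) * (v ++ w) i)) (+-cong
    (sum-cong-≋ (λ i → *-congˡ (reflexive (lookup-++ˡ v w i))))
    (sum-cong-≋ (λ i → *-congˡ (reflexive (lookup-++ʳ v w i)))))

  -- From `¬ s ≈ 0#` alone `s` cannot be inverted, as that takes apartness. Instead `t` is shown not
  -- to be apart from zero, since an inverse of `t` would force `s ≈ 0#`; tightness then gives
  -- `t ≈ 0#`.
  no-zero-divisors : ∀ {s t} → ¬ s ≈ 0# → s * t ≈ 0# → t ≈ 0#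
  no-zero-divisors {s} {t} s≉0 st≈0 = proj₁ (tight t 0#) λ t#0 →
    let u , _ , tu≈1 = #⇒invertible t#0 in s≉0 (begin
      s                       ≈⟨ *-identityʳ s ⟨
      s * 1#                  ≈⟨ *-congˡ tu≈1 ⟨
      -- `t # 0#` inverts the difference of `t` and `0#`, which has to be simplified to `t`.
      s * ((t + - 0#) * u)    ≈⟨ *-congˡ (*-congʳ (≈-trans (+-congˡ -0#≈0#) (+-identityʳ t))) ⟩
      s * (t * u)             ≈⟨ *-assoc s t u ⟨
      s * t * u               ≈⟨ *-congʳ st≈0 ⟩
      0# * u                  ≈⟨ zeroˡ u ⟩
      0#                      ∎)

  -- Every subfield contains ℚ.

  module _ {p} (E : Subfield Q̄ p) where
    open Subfield E hiding (member) renaming (resp to ≈-closed)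

    sum-closed : ∀ {n} (f : Fin n → Carrier) → (∀ i → member E (f i)) → member E (sum f)
    sum-closed {zero}  f f∈E = 0-closed
    sum-closed {suc n} f f∈E = +-closed (f∈E zero) (sum-closed (tail f) (f∈E ∘ suc))

    ℕ-closed : ∀ m → member E (ι ((+ m) / 1))
    ℕ-closed zero    = ≈-closed (≈-sym ι.0#-homo) 0-closed
    ℕ-closed (suc m) = ≈-closed
      (≈-sym (≈-trans (ι-cong (1+m/1 m)) (≈-trans (ι.+-homo 1ℚ _) (+-congʳ ι.1#-homo))))
      (+-closed 1-closed (ℕ-closed m))

    unitFraction-closed : ∀ d .{{_ : NonZero d}} → member E (ι ((+ 1) / d))
    unitFraction-closed d = inv-closed (ℕ-closed d) (begin
      ι ((+ d) / 1) * ι ((+ 1) / d)   ≈⟨ *-comm _ _ ⟩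
      ι ((+ 1) / d) * ι ((+ d) / 1)   ≈⟨ ι.*-homo _ _ ⟨
      ι ((+ 1) / d ℚ.* ((+ d) / 1))     ≈⟨ ι-cong (m/d*d 1 d) ⟩
      ι 1ℚ                            ≈⟨ ι.1#-homo ⟩
      1#                              ∎)

    /-closed : ∀ m d .{{_ : NonZero d}} → member E (ι ((+ m) / d))
    /-closed m d = ≈-closed (begin
      ι ((+ m) / 1) * ι ((+ 1) / d)                  ≈⟨ *-congʳ (ι-cong (m/d*d m d)) ⟨
      ι ((+ m) / d ℚ.* ((+ d) / 1)) * ι ((+ 1) / d)    ≈⟨ *-congʳ (ι.*-homo _ _) ⟩
      ι ((+ m) / d) * ι ((+ d) / 1) * ι ((+ 1) / d)  ≈⟨ *-assoc _ _ _ ⟩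
      ι ((+ m) / d) * (ι ((+ d) / 1) * ι ((+ 1) / d)) ≈⟨ *-congˡ (≈-trans (*-comm _ _) (≈-sym (ι.*-homo _ _))) ⟩
      ι ((+ m) / d) * ι ((+ 1) / d ℚ.* ((+ d) / 1))    ≈⟨ *-congˡ (≈-trans (ι-cong (m/d*d 1 d)) ι.1#-homo) ⟩
      ι ((+ m) / d) * 1#                             ≈⟨ *-identityʳ _ ⟩
      ι ((+ m) / d)                                  ∎)
      (*-closed (ℕ-closed m) (unitFraction-closed d))

    -- The natural numbers are sums of ones, `inv-closed` gives the unit fractions, products give
    -- the nonnegative fractions, and negation gives the rest.
    ℚ-closed : ∀ q → member E (ι q)
    ℚ-closed q with ↥ q in eq
    ... | + m      = subst (λ r → member E (ι r))
      (trans (cong (_/ ↧ₙ q) (sym eq)) (ℚ.↥p/↧p≡p q)) (/-closed m (↧ₙ q))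
    ... | -[1+ m ] = ≈-closed (≈-trans (≈-sym (ι.-‿homo _))
        (ι-cong (trans (cong (_/ ↧ₙ q) (sym eq)) (ℚ.↥p/↧p≡p q))))
      (neg-closed (/-closed (suc m) (↧ₙ q)))

    ·-closed : ∀ {n} q (v : Fin n → Carrier) → (∀ i → member E (v i)) → member E (q · v)
    ·-closed q v v∈E = sum-closed _ (λ i → *-closed (ℚ-closed (q i)) (v∈E i))

  -- Linear dependence and inverses in a field of finite degree.

  module _ {p} {F : Subfield Q̄ p} {d} (deg : [ F :ℚ]≡ d) where
    open [_:ℚ]≡_ deg

    -- The coordinates of the `m` elements in the basis form `d` homogeneous equations in `m > d`
    -- unknowns. After the double sum is exchanged, a solution makes the coefficient of every basis
    -- element zero.
    dependent : ∀ {m} → d ℕ.< m → (v : Fin m → Carrier) → (∀ i → member F (v i)) →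
                Σ[ q ∈ (Fin m → ℚ) ] (∃[ i ] q i ≢ 0ℚ) × q · v ≈ 0#
    dependent {m} d<m v v∈F with q , q≢0 , rel ← linearRelation d<m (λ i → proj₁ (spanning (v i) (v∈F i))) =
      q , q≢0 , (begin
        q · v
          ≈⟨ sum-cong-≋ (λ i → *-congˡ (proj₂ (spanning (v i) (v∈F i)))) ⟩
        sum (λ i → ι (q i) * w i · basis)
          ≈⟨ sum-cong-≋ (λ i → ≈-trans (*-distribˡ-sum (ι (q i)) (λ j → ι (w i j) * basis j))
               (sum-cong-≋ (λ j → ≈-trans (≈-sym (*-assoc _ _ _)) (*-congʳ (≈-sym (ι.*-homo (q i) (w i j))))))) ⟩
        sum (λ i → sum (λ j → ι (q i ℚ.* w i j) * basis j))
          ≈⟨ ∑-comm (λ i j → ι (q i ℚ.* w i j) * basis j) ⟩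
        sum (λ j → sum (λ i → ι (q i ℚ.* w i j) * basis j))
          ≈⟨ sum-cong-≋ (λ j → ≈-trans (≈-sym (*-distribʳ-sum (basis j) (λ i → ι (q i ℚ.* w i j))))
               (*-congʳ (≈-sym (ι-sum (λ i → q i ℚ.* w i j))))) ⟩
        (λ j → ℚΣ.sum (λ i → q i ℚ.* w i j)) · basis
          ≈⟨ ·-zero basis rel ⟩
        0# ∎)
      where
      w : Fin m → Fin d → ℚ
      w i = proj₁ (spanning (v i) (v∈F i))

    independent⇒≤degree : ∀ {m} (v : Fin m → Carrier) → (∀ i → member F (v i)) →
                          Independent v → m ℕ.≤ d
    independent⇒≤degree v v∈F indep = ℕ.≮⇒≥ λ d<m →
      let q , (i , qi≢0) , rel = dependent d<m v v∈F in qi≢0 (indep q rel i)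

    -- The 1 + d elements 1, s b₁, …, s b_d are related, and 1 occurs in the
    -- relation because multiplication by s is injective.
    invertible : ∀ {s} → member F s → ¬ s ≈ 0# → ∃[ y ] s * y ≈ 1#
    invertible {s} s∈F s≉0
      with q , (i , qi≢0) , rel ← dependent (ℕ.n<1+n d) (1# ∷ λ i → s * basis i)
             (λ { zero → Subfield.1-closed F ; (suc i) → Subfield.*-closed F s∈F (inside i) }) =
      -- Solves `ι q₀ + s * t ≈ 0#` for the inverse of `s`.
      ι (1/ q₀) * - t , (begin
        s * (ι (1/ q₀) * - t)         ≈⟨ *-assoc _ _ _ ⟨
        s * ι (1/ q₀) * - t           ≈⟨ *-congʳ (*-comm _ _) ⟩
        ι (1/ q₀) * s * - t           ≈⟨ *-assoc _ _ _ ⟩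
        ι (1/ q₀) * (s * - t)         ≈⟨ *-congˡ (-‿distribʳ-* s t) ⟨
        ι (1/ q₀) * - (s * t)         ≈⟨ *-congˡ (inverseˡ-unique (ι q₀) (s * t) rel′) ⟨
        ι (1/ q₀) * ι q₀              ≈⟨ ι.*-homo (1/ q₀) q₀ ⟨
        ι (1/ q₀ ℚ.* q₀)              ≈⟨ ι-cong (ℚ.*-inverseˡ q₀) ⟩
        ι 1ℚ                          ≈⟨ ι.1#-homo ⟩
        1#                            ∎)
      where
      q₀ = q zero
      t  = tail q · basis

      rel′ : ι q₀ + s * t ≈ 0#
      rel′ = ≈-trans (+-cong (≈-sym (*-identityʳ _)) (≈-sym (·-*ˡ (tail q) s basis))) rel

      q₀≢0 : q₀ ≢ 0ℚ
      -- Without the term in 1 the relation reads `s * t ≈ 0#`, so `t ≈ 0#`, and independence of the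
      -- basis makes every coefficient zero.
      q₀≢0 q₀≡0 = qi≢0 (q≡0 i)
        where
        st≈0 : s * t ≈ 0#
        st≈0 = ≈-trans (≈-sym (+-identityˡ _))
          (≈-trans (+-congʳ (≈-sym (≈-trans (ι-cong q₀≡0) ι.0#-homo))) rel′)

        q≡0 : ∀ i → q i ≡ 0ℚ
        q≡0 zero    = q₀≡0
        q≡0 (suc i) = independent (tail q) (no-zero-divisors s≉0 st≈0) i

      instance _ = ≢-nonZero q₀≢0

    -- The 2m elements e₁, …, e_m, x e₁, …, x e_m satisfy a relation t + x s = 0
    -- with s, t ∈ K, and s ≠ 0 because the e_i are independent.
    degree<2m⇒∈ : ∀ {r} (K : Subfield Q̄ r) {m} (e : Fin m → Carrier) → Independent e →
                  (∀ i → member K (e i)) → (∀ i → member F (e i)) →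
                  ∀ {x} → (∀ i → member F (x * e i)) → d ℕ.< m ℕ.+ m → member K x
    degree<2m⇒∈ K {m} e indep e∈K e∈F {x} xe∈F d<2m
      with q , (i , qi≢0) , rel ← dependent d<2m (e ++ (λ i → x * e i)) (++⁺ (member F) e∈F xe∈F)
      = K.resp x≈ (K.*-closed (K.neg-closed t∈K) (K.inv-closed s∈K (proj₂ s⁻¹)))
      where
      module K = Subfield K

      qˡ qʳ : Fin m → ℚ
      qˡ i = q (i ↑ˡ m)
      qʳ i = q (m ↑ʳ i)

      s t : Carrier
      s = qʳ · e
      t = qˡ · e

      s∈K = ·-closed K qʳ e e∈K
      t∈K = ·-closed K qˡ e e∈K

      t+xs≈0 : t + x * s ≈ 0#
      t+xs≈0 = begin
        t + x * s                   ≈⟨ +-congˡ (·-*ˡ qʳ x e) ⟨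
        t + qʳ · (λ i → x * e i)    ≈⟨ ·-++ q e (λ i → x * e i) ⟨
        q · (e ++ (λ i → x * e i))  ≈⟨ rel ⟩
        0#                          ∎

      s≉0 : ¬ s ≈ 0#
      -- If `s` vanishes then so does `t`, and independence kills both halves of `q`; `splitAt`
      -- tells which half holds the nonzero coefficient.
      s≉0 s≈0 = qi≢0 (trans (cong q (sym (join-splitAt m m i))) (q-join≡0 (splitAt m i)))
        where
        t≈0 : t ≈ 0#
        t≈0 = begin
          t          ≈⟨ +-identityʳ t ⟨
          t + 0#     ≈⟨ +-congˡ (≈-trans (*-congˡ s≈0) (zeroʳ x)) ⟨
          t + x * s  ≈⟨ t+xs≈0 ⟩
          0#         ∎

        q-join≡0 : ∀ k → q (join m m k) ≡ 0ℚ
        q-join≡0 (inj₁ j) = indep qˡ t≈0 j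
        q-join≡0 (inj₂ j) = indep qʳ s≈0 j

      -- The finite degree of `F` supplies the inverse of `s`; `inv-closed` then places it in `K`.
      s⁻¹ = invertible (·-closed F qʳ e e∈F) s≉0
      y   = proj₁ s⁻¹

      x≈ : - t * y ≈ x
      x≈ = begin
        - t * y      ≈⟨ *-congʳ (inverseʳ-unique t (x * s) t+xs≈0) ⟨
        x * s * y    ≈⟨ *-assoc x s y ⟩
        x * (s * y)  ≈⟨ *-congˡ (proj₂ s⁻¹) ⟩
        x * 1#       ≈⟨ *-identityʳ x ⟩
        x            ∎

  -- Inclusions forced by degrees.

  1-independent : Independent {1} (λ _ → 1#)
  1-independent q q1≈0 zero = ι-injective₀ (≈-trans (≈-sym (≈-trans (+-identityʳ _) (*-identityʳ _))) q1≈0)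

  -- The case m = 1 inside `L` itself: 1 and `x` are two elements of a space of dimension 1 < 2.
  degree1-⊆ : ∀ {p r} (K : Subfield Q̄ p) (L : Subfield Q̄ r) → [ L :ℚ]≡ 1 →
              ∀ {x} → member L x → member K x
  degree1-⊆ K L degL {x} x∈L = degree<2m⇒∈ degL K (λ _ → 1#) 1-independent
    (λ _ → Subfield.1-closed K) (λ _ → Subfield.1-closed L)
    (λ _ → Subfield.*-closed L x∈L (Subfield.1-closed L)) (ℕ.n<1+n 1)

  -- A Galois `K` is one of the fields `M` being intersected, its level being the one over which `M`
  -- ranges. The closure thus lies in `K`, and its basis is an independent family there.
  degree-galoisClosure≤ : ∀ {K : Subfield Q̄ (c ⊔ ℓ₁)} {n d} → IsGalois K →
                          [ K :ℚ]≡ n → [ galoisClosure K :ℚ]≡ d → d ℕ.≤ n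
  degree-galoisClosure≤ {K} galK degK degK̃ =
    independent⇒≤degree degK basis (λ i → inside i K galK (λ z → z)) independent
    where open [_:ℚ]≡_ degK̃

  -- The independent family is a basis of `K`; it and its multiples by an element of `L` stay in the
  -- common overfield `F`, later the compositum.
  degree<2n⇒⊆ : ∀ {p q r} {K : Subfield Q̄ p} {L : Subfield Q̄ q} {F : Subfield Q̄ r} {n d} →
                [ K :ℚ]≡ n → [ F :ℚ]≡ d → d ℕ.< n ℕ.+ n →
                (∀ {x} → member K x → member F x) → (∀ {x} → member L x → member F x) →
                ∀ {x} → member L x → member K x
  degree<2n⇒⊆ {K = K} {F = F} degK degF d<2n K⊆F L⊆F x∈L =
    degree<2m⇒∈ degF K basis independent inside (K⊆F ∘ inside)
      (λ i → Subfield.*-closed F (L⊆F x∈L) (K⊆F (inside i))) d<2n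
    where open [_:ℚ]≡_ degK

theorem3p7 : ∀ {c ℓ₁ ℓ₂ : Level} (Q̄ : AlgebraicClosureOfℚ c ℓ₁ ℓ₂)
    (n : ℕ) .{{n≢0 : NonZero n}} (K L : Subfield Q̄ (c ⊔ ℓ₁)) →
    [ K :ℚ]≡ n → [ L :ℚ]≡ n → IsGalois K → IsGalois L →
    ∀ (δ : ℚ) → IsDelta K L δ →
    δ > 1ℚ - (_/_ (+ 2) (n ^ 2) {{m^n≢0 n 2}}) →
    member K ≐ member L
-- Here 2/n² exceeds 1/n and `δ-bound` fails to apply, but each field of degree 1 lies in every
-- subfield.
theorem3p7 Q̄ 1 K L degK degL galK galL δ isδ δ> = degree1-⊆ L K degK , degree1-⊆ K L degL
theorem3p7 Q̄ n@(suc (suc _)) K L degK degL galK galL δ isδ δ> =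
  degree<2n⇒⊆ {L = K} degL degKL dKL<2n L⊆KL K⊆KL , degree<2n⇒⊆ {L = L} degK degKL dKL<2n K⊆KL L⊆KL
  where
  open IsDelta isδ using (dK; dL; dKL; degKL; value) renaming (degK to degK̃; degL to degL̃)

  dKL<2n : dKL ℕ.< n ℕ.+ n
  dKL<2n = δ-bound {n} {dKL} {dK} {dL}
    {{_}} {{degree-nonZero degKL}} {{degree-nonZero degK̃}} {{degree-nonZero degL̃}}
    (s≤s (s≤s z≤n)) (degree-galoisClosure≤ galK degK degK̃) (degree-galoisClosure≤ galL degL degL̃)
    (subst (_> 1ℚ - (+ 2) / (n ^ 2)) value δ>)

  K⊆KL : ∀ {x} → member K x → member (compositum (galoisClosure K) (galoisClosure L)) x
  K⊆KL x∈K = left (λ M _ K⊆M → K⊆M x∈K)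

  L⊆KL : ∀ {x} → member L x → member (compositum (galoisClosure K) (galoisClosure L)) x
  L⊆KL x∈L = right (λ M _ L⊆M → L⊆M x∈L)
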